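{- (1) Let $\mathbb{P}_\tau=(P_o,P_a,\vDash,\mathcal{F}_\tau)$ be a multiplicative attribute continuous formal context. Then $(\mathfrak{B}(P_a,\mathcal{F}_\tau),\subseteq)$ is a stably continuous semilattice. (2) For any stably continuous semilattice $(D,\leq)$ with a basis $B_D$, the associated attribute continuous formal context $Rep(D)=(D,B_D,\geq,\mathcal{F}_\tau)$ is multiplicative.
   Context: Domain theory. Posets are assumed nonempty. A dcpo is a poset in which every directed (nonempty, upward directed) subset has a least upper bound. In a dcpo $P$, $x\ll y$ means: for every directed $D\subseteq P$ with $y\leq\bigvee D$ there is $d\in D$ with $x\leq d$. A basis of $P$ is a subset $B\subseteq P$ such that for every $x\in P$ the set $\{b\in B: b\ll x\}$ is directed with least upper bound $x$. A continuous domain is a dcpo that has a basis. A semilattice is a poset in which any two elements $x,y$ have a greatest lower bound $x\wedge y$. A stably continuous semilattice is a continuous domain that is a semilattice and in which $\ll$ is multiplicative: $x\ll y$ and $x\ll z$ imply $x\ll y\wedge z$. Notation: $M\sqsubseteq X$ means that $M$ is a finite subset of $X$ (possibly empty). A formal context is a triple $(P_o,P_a,\vDash)$ with sets $P_o$ (objects), $P_a$ (attributes) and a relation $\vDash\subseteq P_o\times P_a$. Define $\alpha(A)=\{n\in P_a:\forall m\in A,\ m\vDash n\}$ for $A\subseteq P_o$ and $\omega(B)=\{m\in P_o:\forall n\in B,\ m\vDash n\}$ for $B\subseteq P_a$. A kernel attribute operator on $(P_o,P_a,\vDash)$ is a map $\tau:\mathcal{P}(P_a)\to\mathcal{P}(P_a)$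 such that for all $B,B_1\subseteq P_a$: $\tau(\alpha(\omega(B)))\subseteq\alpha(\omega(B))$; $\tau(\tau(\alpha(\omega(B))))=\tau(\alpha(\omega(B)))$; and $\tau(\alpha(\omega(B)))\subseteq\tau(\alpha(\omega(B_1)))$ whenever $B\subseteq B_1$. Write $\lceil B\rceil=\tau(\alpha(\omega(B)))$. A $\tau$-consistent selection is a nonempty family $\mathcal{F}_\tau$ of nonempty finite subsets of $P_a$ such that for every $F\in\mathcal{F}_\tau$ and every $M\sqsubseteq\lceil F\rceil$ there is $G\in\mathcal{F}_\tau$ with $M\subseteq\lceil G\rceil$ and $G\subseteq\lceil F\rceil$. An attribute continuous formal context is a structure $\mathbb{P}_\tau=(P_o,P_a,\vDash,\mathcal{F}_\tau)$ where $(P_o,P_a,\vDash)$ is a formal context, $\tau$ is a kernel attribute operator on it and $\mathcal{F}_\tau$ is a $\tau$-consistent selection. It is called multiplicative if for all $F_1,F_2,G_1,G_2\in\mathcal{F}_\tau$: (SS1) for every $M\sqsubseteq\lceil F_1\rceil\cap\lceil F_2\rceil$ there is $F\in\mathcal{F}_\tau$ with $F\subseteq\lceil F_1\rceil\cap\lceil F_2\rceil$ and $M\subseteq\lceil F\rceil$; (SS2) if $G_1\subseteq\lceil F_1\rceil$ and $G_2\subseteq\lceil F_2\rceil$, then there are $F,G\in\mathcal{F}_\tau$ with $\lceil G_1\rceil\cap\lceil G_2\rceil\subseteq\lceil G\rceil$ and $G\subseteq\lceil F\rceil\subseteq\lceil F_1\rceil\cap\lceil F_2\rceil$. A continuous formal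 concept of $\mathbb{P}_\tau$ is a subset $Q\subseteq P_a$ such that for every $M\sqsubseteq Q$ there is $F\in\mathcal{F}_\tau$ with $M\subseteq\lceil F\rceil\subseteq Q$. The set of all of them is $\mathfrak{B}(P_a,\mathcal{F}_\tau)$. For a continuous domain $(D,\leq)$ with basis $B_D$, the associated attribute continuous formal context $Rep(D)=(D,B_D,\geq,\mathcal{F}_\tau)$ has objects $P_o=D$, attributes $P_a=B_D$, relation $x\vDash b\Leftrightarrow b\leq x$, operator $\tau(X)=\{b\in B_D:\exists x\in X,\ b\ll x\}$ for $X\subseteq B_D$, and $\mathcal{F}_\tau=\{F\sqsubseteq B_D:\bigvee F \text{ exists and } \bigvee F\in F\}$. -}

module Defs where

open import Axiom.ExcludedMiddle using (ExcludedMiddle)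
open import Data.List.Base using (List; []; _∷_; map)
open import Data.List.Membership.Propositional using () renaming (_∈_ to _∈ₗ_)
open import Data.List.Membership.Propositional.Properties using (∈-map⁺; ∈-map⁻)
open import Data.List.Relation.Binary.BagAndSetEquality using (_∼[_]_; set)
open import Data.List.Relation.Unary.Any using (here; there)
open import Data.Product.Base using (_×_; _,_; ∃; proj₁; proj₂)
open import Function.Base using (_∘_; id)
open import Function.Bundles using (module Equivalence)
open import Level using (Level; _⊔_; Lift; lift; lower; suc)
open import Relation.Binary.Bundles using (Poset)
open import Relation.Binary.Core using (REL)
open import Relation.Binary.Lattice.Structures using (IsMeetSemilattice)
open import Relation.Binary.PropositionalEquality.Core using (_≡_; refl)
open import Relation.Nullary.Decidable.Core using (True; toWitness; fromWitness)
open import Relation.Nullary.Negation.Core using (¬_)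
open import Relation.Unary using (Pred; _∈_; _⊆_; _∩_; _≐_; Satisfiable)

------------------------------------------------------------------------
-- Domain theory

-- A subset of a poset is a `Pred` on its carrier.  Since Agda is
-- predicative, "every subset" has to mean "every subset at some universe
-- level"; this level is the parameter d below.  Under excluded middle
-- every predicate is equivalent to one at any other level, so the choice
-- of d does not affect the meaning of the notions.

module _ {c ℓ₁ ℓ₂} (P : Poset c ℓ₁ ℓ₂) where
  open Poset P

  record IsDirected {q} (D : Pred Carrier q) : Set (c ⊔ ℓ₂ ⊔ q) where
    field
      nonempty : Satisfiable D
      upward   : ∀ x y → x ∈ D → y ∈ D → ∃ λ z → z ∈ D × x ≤ z × y ≤ z

  IsLub : ∀ {q} → Pred Carrier q → Pred Carrier (c ⊔ ℓ₂ ⊔ q)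
  IsLub D s = (∀ x → x ∈ D → x ≤ s) ×
              (∀ u → (∀ x → x ∈ D → x ≤ u) → s ≤ u)

  -- Posets are nonempty by convention, whence the first field.
  record IsDcpo d : Set (c ⊔ ℓ₂ ⊔ suc d) where
    field
      nonempty : Carrier
      complete : (D : Pred Carrier d) → IsDirected D → ∃ (IsLub D)

  WayBelow : ∀ d → Carrier → Carrier → Set (c ⊔ ℓ₂ ⊔ suc d)
  WayBelow d x y = (D : Pred Carrier d) → IsDirected D →
                   ∀ s → IsLub D s → y ≤ s → ∃ λ e → e ∈ D × x ≤ e

  BasisBelow : ∀ d → Pred Carrier d → Carrier → Pred Carrier (c ⊔ ℓ₂ ⊔ suc d)
  BasisBelow d B x b = b ∈ B × WayBelow d b x

  IsBasis : ∀ d → Pred Carrier d → Set (c ⊔ ℓ₂ ⊔ suc d)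
  IsBasis d B = ∀ x → IsDirected (BasisBelow d B x) × IsLub (BasisBelow d B x) x

  record IsContinuousDomain d : Set (c ⊔ ℓ₂ ⊔ suc d) where
    field
      isDcpo   : IsDcpo d
      hasBasis : ∃ (IsBasis d)

  record IsStablyContinuousSemilattice d : Set (c ⊔ ℓ₁ ⊔ ℓ₂ ⊔ suc d) where
    field
      isContinuousDomain : IsContinuousDomain d
      _∧_                : Carrier → Carrier → Carrier
      isMeetSemilattice  : IsMeetSemilattice _≈_ _≤_ _∧_
      multiplicative     : ∀ x y z → WayBelow d x y → WayBelow d x z →
                           WayBelow d x (y ∧ z)

------------------------------------------------------------------------
-- Formal contexts

record FormalContext o a r : Set (suc (o ⊔ a ⊔ r)) where
  infix 4 _⊨_
  field
    Obj  : Set o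
    Attr : Set a
    _⊨_  : REL Obj Attr r

  α : ∀ {q} → Pred Obj q → Pred Attr (o ⊔ r ⊔ q)
  α A n = ∀ m → m ∈ A → m ⊨ n

  ω : ∀ {q} → Pred Attr q → Pred Obj (a ⊔ r ⊔ q)
  ω B m = ∀ n → n ∈ B → m ⊨ n

-- The powerset of the attributes is taken at a level closed under α ∘ ω;
-- the extra level s allows it to be larger if needed.

module _ {o a r} (K : FormalContext o a r) (s : Level) where
  open FormalContext K

  𝒫Attr : Set (suc (o ⊔ a ⊔ r ⊔ s))
  𝒫Attr = Pred Attr (o ⊔ a ⊔ r ⊔ s)

  record IsKernelAttributeOperator (τ : 𝒫Attr → 𝒫Attr) :
         Set (suc (o ⊔ a ⊔ r ⊔ s)) where
    field
      -- τ is a map on subsets, i.e. it respects extensional equality.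
      cong         : ∀ {X Y : 𝒫Attr} → X ≐ Y → τ X ≐ τ Y
      deflationary : ∀ (B : 𝒫Attr) → τ (α (ω B)) ⊆ α (ω B)
      idempotent   : ∀ (B : 𝒫Attr) → τ (τ (α (ω B))) ≐ τ (α (ω B))
      monotone     : ∀ {B B₁ : 𝒫Attr} → B ⊆ B₁ → τ (α (ω B)) ⊆ τ (α (ω B₁))

  -- Finite subsets are given by lists of their elements.

  ⟨_⟩ : List Attr → 𝒫Attr
  ⟨ M ⟩ n = Lift (o ⊔ a ⊔ r ⊔ s) (n ∈ₗ M)

  record IsConsistentSelection {f} (τ : 𝒫Attr → 𝒫Attr) (𝓕 : Pred (List Attr) f) :
         Set (o ⊔ a ⊔ r ⊔ s ⊔ f) where
    private
      ⌈_⌉ : List Attr → 𝒫Attr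
      ⌈ F ⌉ = τ (α (ω ⟨ F ⟩))
    field
      -- 𝓕 is a family of subsets, so it only depends on the set of
      -- elements of a list.
      respects   : ∀ {F G} → F ∼[ set ] G → F ∈ 𝓕 → G ∈ 𝓕
      inhabited  : Satisfiable 𝓕
      nonempty   : ∀ {F} → F ∈ 𝓕 → ¬ F ≡ []
      consistent : ∀ {F} → F ∈ 𝓕 → ∀ M → ⟨ M ⟩ ⊆ ⌈ F ⌉ →
                   ∃ λ G → G ∈ 𝓕 × ⟨ M ⟩ ⊆ ⌈ G ⌉ × ⟨ G ⟩ ⊆ ⌈ F ⌉

record AttributeContinuousContext o a r s f : Set (suc (o ⊔ a ⊔ r ⊔ s ⊔ f)) where
  field
    formalContext : FormalContext o a r
  open FormalContext formalContext public
  field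
    τ                     : 𝒫Attr formalContext s → 𝒫Attr formalContext s
    isKernel              : IsKernelAttributeOperator formalContext s τ
    𝓕                     : Pred (List Attr) f
    isConsistentSelection : IsConsistentSelection formalContext s τ 𝓕

  fin : List Attr → 𝒫Attr formalContext s
  fin = ⟨_⟩ formalContext s

  ⌈_⌉ : List Attr → 𝒫Attr formalContext s
  ⌈ F ⌉ = τ (α (ω (fin F)))

module _ {o a r s f} (ℙ : AttributeContinuousContext o a r s f) where
  open AttributeContinuousContext ℙ

  record IsMultiplicative : Set (o ⊔ a ⊔ r ⊔ s ⊔ f) where
    field
      SS1 : ∀ {F₁ F₂} → F₁ ∈ 𝓕 → F₂ ∈ 𝓕 →
            ∀ M → fin M ⊆ ⌈ F₁ ⌉ ∩ ⌈ F₂ ⌉ →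
            ∃ λ F → F ∈ 𝓕 × fin F ⊆ ⌈ F₁ ⌉ ∩ ⌈ F₂ ⌉ × fin M ⊆ ⌈ F ⌉
      SS2 : ∀ {F₁ F₂ G₁ G₂} → F₁ ∈ 𝓕 → F₂ ∈ 𝓕 → G₁ ∈ 𝓕 → G₂ ∈ 𝓕 →
            fin G₁ ⊆ ⌈ F₁ ⌉ → fin G₂ ⊆ ⌈ F₂ ⌉ →
            ∃ λ F → ∃ λ G → F ∈ 𝓕 × G ∈ 𝓕 ×
              ⌈ G₁ ⌉ ∩ ⌈ G₂ ⌉ ⊆ ⌈ G ⌉ ×
              fin G ⊆ ⌈ F ⌉ ×
              ⌈ F ⌉ ⊆ ⌈ F₁ ⌉ ∩ ⌈ F₂ ⌉

  IsContinuousFormalConcept : 𝒫Attr formalContext s → Set (o ⊔ a ⊔ r ⊔ s ⊔ f)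
  IsContinuousFormalConcept Q =
    ∀ M → fin M ⊆ Q → ∃ λ F → F ∈ 𝓕 × fin M ⊆ ⌈ F ⌉ × ⌈ F ⌉ ⊆ Q

  𝔅 : Poset (suc (o ⊔ a ⊔ r ⊔ s) ⊔ f) (o ⊔ a ⊔ r ⊔ s) (o ⊔ a ⊔ r ⊔ s)
  𝔅 = record
    { Carrier        = ∃ IsContinuousFormalConcept
    ; _≈_            = λ Q R → proj₁ Q ≐ proj₁ R
    ; _≤_            = λ Q R → proj₁ Q ⊆ proj₁ R
    ; isPartialOrder = record
      { isPreorder = record
        { isEquivalence = record
          { refl  = id , id
          ; sym   = λ (p , q) → q , p
          ; trans = λ (p , q) (p′ , q′) → (λ x → p′ (p x)) , (λ x → q (q′ x))
          }
        ; reflexive     = proj₁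
        ; trans         = λ p q x → q (p x)
        }
      ; antisym    = _,_
      }
    }

------------------------------------------------------------------------
-- The context associated with a continuous domain and one of its bases

module _ {c ℓ₁ ℓ₂ d} (D : Poset c ℓ₁ ℓ₂) (B : Pred (Poset.Carrier D) d) where
  open Poset D

  RepContext : FormalContext c (c ⊔ d) ℓ₂
  RepContext = record
    { Obj  = Carrier
    ; Attr = ∃ B
    ; _⊨_  = λ x b → proj₁ b ≤ x
    }

  RepOperator : 𝒫Attr RepContext (suc d) → 𝒫Attr RepContext (suc d)
  RepOperator X b = ∃ λ x → x ∈ X × WayBelow D d (proj₁ b) (proj₁ x)

  elements : List (∃ B) → List Carrier
  elements = map proj₁

  RepSelection : Pred (List (∃ B)) (c ⊔ ℓ₂)
  RepSelection F = ∃ λ s → IsLub D (_∈ₗ elements F) s × s ∈ₗ elements F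

-- Excluded middle is only used to move subsets between universe levels,
-- in the proof of the interpolation property of ≪.

module Representation
         (em : ∀ {ℓ} → ExcludedMiddle ℓ)
         {c ℓ₁ ℓ₂ d} (D : Poset c ℓ₁ ℓ₂) (isDcpo : IsDcpo D d)
         (B : Pred (Poset.Carrier D) d) (isBasis : IsBasis D d B) where
  open Poset D renaming (refl to ≤-refl; trans to ≤-trans)

  infix 4 _≪_
  _≪_ : Carrier → Carrier → Set (c ⊔ ℓ₂ ⊔ suc d)
  _≪_ = WayBelow D d

  ≪-≤-trans : ∀ {x y z} → x ≪ y → y ≤ z → x ≪ z
  ≪-≤-trans x≪y y≤z E dir s lub z≤s = x≪y E dir s lub (≤-trans y≤z z≤s)

  ≤-≪-trans : ∀ {x y z} → x ≤ y → y ≪ z → x ≪ z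
  ≤-≪-trans x≤y y≪z E dir s lub z≤s with y≪z E dir s lub z≤s
  ... | e , e∈E , y≤e = e , e∈E , ≤-trans x≤y y≤e

  module Below (x : Carrier) where
    open IsDirected (proj₁ (isBasis x)) public
    upper : ∀ {b} → b ∈ B → b ≪ x → b ≤ x
    upper b∈B b≪x = proj₁ (proj₂ (isBasis x)) _ (b∈B , b≪x)
    least : ∀ u → (∀ b → BasisBelow D d B x b → b ≤ u) → x ≤ u
    least = proj₂ (proj₂ (isBasis x))

  -- The elements of B way below some basis element way below y, as a
  -- subset at level d.
  DoublyBelow : Carrier → Pred Carrier d
  DoublyBelow y e =
    Lift d (True (em {P = e ∈ B × ∃ λ b → b ∈ B × e ≪ b × b ≪ y}))

  doublyBelow-directed : ∀ y → IsDirected D (DoublyBelow y)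
  doublyBelow-directed y = record
    { nonempty =
        let b , b∈B , b≪y = Below.nonempty y
            e , e∈B , e≪b = Below.nonempty b
        in e , lift (fromWitness (e∈B , b , b∈B , e≪b , b≪y))
    ; upward = λ _ _ (lift p) (lift q) →
        let e₁∈B , b₁ , b₁∈B , e₁≪b₁ , b₁≪y = toWitness p
            e₂∈B , b₂ , b₂∈B , e₂≪b₂ , b₂≪y = toWitness q
            b , (b∈B , b≪y) , b₁≤b , b₂≤b =
              Below.upward y _ _ (b₁∈B , b₁≪y) (b₂∈B , b₂≪y)
            e , (e∈B , e≪b) , e₁≤e , e₂≤e =
              Below.upward b _ _ (e₁∈B , ≪-≤-trans e₁≪b₁ b₁≤b)
                             (e₂∈B , ≪-≤-trans e₂≪b₂ b₂≤b)
        in e , lift (fromWitness (e∈B , b , b∈B , e≪b , b≪y)) , e₁≤e , e₂≤e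
    }

  interpolate : ∀ {x y} → x ≪ y → ∃ λ b → b ∈ B × x ≪ b × b ≪ y
  interpolate {x} {y} x≪y =
    let s , s-lub = IsDcpo.complete isDcpo (DoublyBelow y) (doublyBelow-directed y)
        y≤s = Below.least y s λ b (b∈B , b≪y) →
                Below.least b s λ e (e∈B , e≪b) →
                  proj₁ s-lub e (lift (fromWitness (e∈B , b , b∈B , e≪b , b≪y)))
        e , lift e∈E , x≤e = x≪y (DoublyBelow y) (doublyBelow-directed y) s s-lub y≤s
        _ , b , b∈B , e≪b , b≪y = toWitness e∈E
    in b , b∈B , ≤-≪-trans x≤e e≪b , b≪y

  context = RepContext D B
  τ       = RepOperator D B
  𝓕       = RepSelection D B

  open FormalContext context using (α; ω)

  Subset : Set _
  Subset = 𝒫Attr context (suc d)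

  fin : List (∃ B) → Subset
  fin = ⟨_⟩ context (suc d)

  αω-lower : ∀ (X : Subset) {b b′} → proj₁ b ≤ proj₁ b′ → α (ω X) b′ → α (ω X) b
  αω-lower X b≤b′ b′∈ m m∈ = ≤-trans b≤b′ (b′∈ m m∈)

  ≪⇒≤ : ∀ (b : ∃ B) {x} → proj₁ b ≪ x → proj₁ b ≤ x
  ≪⇒≤ (_ , b∈B) {x} = Below.upper x b∈B

  isKernel : IsKernelAttributeOperator context (suc d) τ
  isKernel = record
    { cong         = λ (p , q) → (λ (x , x∈X , b≪x) → x , p x∈X , b≪x)
                               , (λ (x , x∈Y , b≪x) → x , q x∈Y , b≪x)
    ; deflationary = λ X {b} (x , x∈ , b≪x) →
                       αω-lower X {b} {x} (≪⇒≤ b b≪x) x∈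
    ; idempotent   = λ X →
          (λ { (x , (y , y∈ , x≪y) , b≪x) →
               y , y∈ , ≪-≤-trans b≪x (≪⇒≤ x x≪y) })
        , (λ { (y , y∈ , b≪y) →
               let x , x∈B , b≪x , x≪y = interpolate b≪y
               in (x , x∈B) , (y , y∈ , x≪y) , b≪x })
    ; monotone     = λ X⊆Y (x , x∈ , b≪x) →
          x , (λ m m∈ → x∈ m λ n n∈ → m∈ n (X⊆Y n∈)) , b≪x
    }

  ⌈_⌉ : List (∃ B) → Subset
  ⌈ F ⌉ = τ (α (ω (fin F)))

  module _ {F} (F∈𝓕 : F ∈ 𝓕) where
    ⌈⌉⇒≪ : ∀ b → b ∈ ⌈ F ⌉ → proj₁ b ≪ proj₁ F∈𝓕
    ⌈⌉⇒≪ b (x , x∈ , b≪x) =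
      ≪-≤-trans b≪x (x∈ _ λ _ (lift n∈F) → proj₁ (proj₁ (proj₂ F∈𝓕)) _ (∈-map⁺ (proj₁ {B = B}) n∈F))

    ≪⇒⌈⌉ : ∀ b → proj₁ b ≪ proj₁ F∈𝓕 → b ∈ ⌈ F ⌉
    ≪⇒⌈⌉ b b≪s with ∈-map⁻ (proj₁ {B = B}) (proj₂ (proj₂ F∈𝓕))
    ... | m , m∈F , refl = m , (λ _ x∈ → x∈ m (lift m∈F)) , b≪s

  singleton∈𝓕 : ∀ (b : ∃ B) → (b ∷ []) ∈ 𝓕
  singleton∈𝓕 b =
    proj₁ b , ((λ { _ (here refl) → ≤-refl }) , λ _ ub → ub _ (here refl)) , here refl

  interpolateAll : ∀ (M : List (∃ B)) {y} → (∀ {b} → b ∈ₗ M → proj₁ b ≪ y) →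
                   ∃ λ x → x ∈ B × x ≪ y × (∀ {b} → b ∈ₗ M → proj₁ b ≪ x)
  interpolateAll []      {y} M≪y =
    let b , b∈B , b≪y = Below.nonempty y in b , b∈B , b≪y , λ ()
  interpolateAll (m ∷ M) {y} M≪y =
    let x₁ , x₁∈B , x₁≪y , M≪x₁ = interpolateAll M (M≪y ∘ there)
        x₂ , x₂∈B , m≪x₂ , x₂≪y = interpolate (M≪y (here refl))
        x , (x∈B , x≪y) , x₁≤x , x₂≤x =
          Below.upward y _ _ (x₁∈B , x₁≪y) (x₂∈B , x₂≪y)
    in x , x∈B , x≪y , λ { (here refl) → ≪-≤-trans m≪x₂ x₂≤x
                         ; (there b∈M) → ≪-≤-trans (M≪x₁ b∈M) x₁≤x }

  isConsistentSelection : IsConsistentSelection context (suc d) τ 𝓕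
  isConsistentSelection = record
    { respects   = λ {F} {G} F∼G (s , (ub , least) , s∈F) →
        let F⊆G = transport F G (Equivalence.to F∼G)
            G⊆F = transport G F (Equivalence.from F∼G)
        in s , ((λ x x∈G → ub x (G⊆F x∈G)) , λ u ub′ → least u λ x x∈F → ub′ x (F⊆G x∈F)) , F⊆G s∈F
    ; inhabited  = let b , b∈B , _ = Below.nonempty (IsDcpo.nonempty isDcpo)
                   in (b , b∈B) ∷ [] , singleton∈𝓕 (b , b∈B)
    ; nonempty   = λ { (_ , _ , ()) refl }
    ; consistent = λ {F} F∈𝓕 M M⊆ →
        let x , x∈B , x≪s , M≪x = interpolateAll M (λ {b} b∈M → ⌈⌉⇒≪ F∈𝓕 b (M⊆ (lift b∈M)))
        in (x , x∈B) ∷ [] , singleton∈𝓕 (x , x∈B)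
         , (λ {b} (lift b∈M) → ≪⇒⌈⌉ (singleton∈𝓕 (x , x∈B)) b (M≪x b∈M))
         , (λ { (lift (here refl)) → ≪⇒⌈⌉ F∈𝓕 (x , x∈B) x≪s })
    }
    where
    transport : ∀ F G → (∀ {b} → b ∈ₗ F → b ∈ₗ G) →
                ∀ {x : Carrier} → x ∈ₗ elements D B F → x ∈ₗ elements D B G
    transport F G F⊆G x∈F with ∈-map⁻ (proj₁ {B = B}) x∈F
    ... | b , b∈F , refl = ∈-map⁺ (proj₁ {B = B}) (F⊆G b∈F)

  Rep : AttributeContinuousContext c (c ⊔ d) ℓ₂ (suc d) (c ⊔ ℓ₂)
  Rep = record
    { formalContext         = context
    ; τ                     = τ
    ; isKernel              = isKernel
    ; 𝓕                     = 𝓕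
    ; isConsistentSelection = isConsistentSelection
    }

open Representation public using (Rep)

-- (1) The union of a directed family of concepts is a concept, and every
-- concept Q is the directed union of the concepts contained in some ⌈ F ⌉
-- with F ∈ 𝓕, F ⊆ Q.  Hence R ≪ Q means exactly R ⊆ ⌈ F ⌉ for such an F.
-- By (SS1) the intersection of two concepts is a concept, and with the
-- above description of ≪ condition (SS2) says that ≪ is multiplicative.
--
-- (2) If F ∈ 𝓕 has maximum s, then ⌈ F ⌉ = { b ∈ B : b ≪ s }.  So (SS1) and
-- (SS2) are interpolation below s₁ ∧ s₂, which is possible because ≪ is
-- multiplicative.

{-# OPTIONS --safe #-}
module Submission where

open import Defs
open import Axiom.ExcludedMiddle using (ExcludedMiddle)
open import Data.List.Base using (List; []; _∷_; _++_)
open import Data.List.Membership.Propositional.Properties using (∈-map⁻; ∈-++⁺ˡ; ∈-++⁺ʳ; ∈-++⁻)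
open import Data.List.Relation.Unary.Any using (here; there)
open import Data.Product.Base using (_×_; _,_; ∃; proj₁; proj₂)
open import Data.Sum.Base using ([_,_])
open import Data.Unit.Polymorphic.Base using (⊤)
open import Function.Base using (_∘_)
open import Level using (Level; Lift; lift)
open import Relation.Binary.Bundles using (Poset)
open import Relation.Binary.Lattice.Structures using (IsMeetSemilattice)
open import Relation.Binary.PropositionalEquality.Core using (refl)
open import Relation.Nullary.Decidable.Core using (True; toWitness; fromWitness)
open import Relation.Unary using (Pred; _∈_; _⊆_; _∩_; _≐_)

-- Moving subsets between universe levels.

module _ (em : ∀ {ℓ} → ExcludedMiddle ℓ) where

  -- Excluded middle decides membership, and `True` of a decision lives at level zero, so `Lift` can
  -- place it at any level `q`.
  Resize : ∀ {a p} {A : Set a} q → Pred A p → Pred A q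
  Resize q P x = Lift q (True (em {P = P x}))

  Resize-≐ : ∀ {a p} {A : Set a} q (P : Pred A p) → P ≐ Resize q P
  Resize-≐ q P = (λ x∈P → lift (fromWitness x∈P)) , (λ (lift t) → toWitness t)

module _ {c ℓ₁ ℓ₂ p q} (P : Poset c ℓ₁ ℓ₂)
         {X : Pred (Poset.Carrier P) p} {Y : Pred (Poset.Carrier P) q} where

  IsDirected-resp-≐ : X ≐ Y → IsDirected P X → IsDirected P Y
  IsDirected-resp-≐ (X⊆Y , Y⊆X) X-dir = record
    { nonempty = let x , x∈X = nonempty in x , X⊆Y x∈X
    ; upward   = λ x y x∈Y y∈Y →
        let z , z∈X , x≤z , y≤z = upward x y (Y⊆X x∈Y) (Y⊆X y∈Y)
        in z , X⊆Y z∈X , x≤z , y≤z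
    }
    where open IsDirected X-dir

  IsLub-resp-≐ : X ≐ Y → ∀ {s} → IsLub P X s → IsLub P Y s
  IsLub-resp-≐ (X⊆Y , Y⊆X) (ub , least) =
    (λ x x∈Y → ub x (Y⊆X x∈Y)) , (λ u u-ub → least u λ x x∈X → u-ub x (X⊆Y x∈X))

-- Concepts: directed unions and the way-below relation.

module Concepts (em : ∀ {ℓ} → ExcludedMiddle ℓ)
                {o a r s f} (ℙ : AttributeContinuousContext o a r s f) where
  open AttributeContinuousContext ℙ
  open IsKernelAttributeOperator isKernel
  open IsConsistentSelection isConsistentSelection using (inhabited; consistent)
  open Poset (𝔅 ℙ) using (Carrier; _≤_)

  -- As `τ` is deflationary on closed sets, `G` lies in the closure `α (ω (fin F))`. Monotonicity
  -- then leads into `τ` of the double closure of `F`, and closure is idempotent.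
  ⌈⌉-least : ∀ {F G} → fin G ⊆ ⌈ F ⌉ → ⌈ G ⌉ ⊆ ⌈ F ⌉
  ⌈⌉-least {F} {G} G⊆⌈F⌉ n∈⌈G⌉ =
    proj₁ (cong αωαω≐αω) (monotone (λ n∈G → deflationary (fin F) (G⊆⌈F⌉ n∈G)) n∈⌈G⌉)
    where
    αωαω≐αω : α (ω (α (ω (fin F)))) ≐ α (ω (fin F))
    αωαω≐αω = (λ n∈ m m∈ → n∈ m λ n′ n′∈ → n′∈ m m∈) , (λ n∈ m m∈ → m∈ _ n∈)

  ⌈_⌉-concept : ∀ {F} → F ∈ 𝓕 → IsContinuousFormalConcept ℙ ⌈ F ⌉
  ⌈ F∈𝓕 ⌉-concept M M⊆⌈F⌉ =
    let G , G∈𝓕 , M⊆⌈G⌉ , G⊆⌈F⌉ = consistent F∈𝓕 M M⊆⌈F⌉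
    in G , G∈𝓕 , M⊆⌈G⌉ , ⌈⌉-least G⊆⌈F⌉

  ⌈⌉⊆concept : ∀ (Q : Carrier) {F} → fin F ⊆ proj₁ Q → ⌈ F ⌉ ⊆ proj₁ Q
  ⌈⌉⊆concept (_ , Q-concept) {F} F⊆Q n∈⌈F⌉ =
    let G , _ , F⊆⌈G⌉ , ⌈G⌉⊆Q = Q-concept F F⊆Q in ⌈G⌉⊆Q (⌈⌉-least F⊆⌈G⌉ n∈⌈F⌉)

  -- The concept condition only bounds `⌈ F ⌉` by `Q`, and `F` need not lie in `⌈ F ⌉`. Consistency
  -- supplies a `G` inside `⌈ F ⌉`, hence itself inside `Q`.
  interpolate : ∀ (Q : Carrier) M → fin M ⊆ proj₁ Q →
                ∃ λ F → F ∈ 𝓕 × fin M ⊆ ⌈ F ⌉ × fin F ⊆ proj₁ Q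
  interpolate (_ , Q-concept) M M⊆Q =
    let F , F∈𝓕 , M⊆⌈F⌉ , ⌈F⌉⊆Q = Q-concept M M⊆Q
        G , G∈𝓕 , M⊆⌈G⌉ , G⊆⌈F⌉ = consistent F∈𝓕 M M⊆⌈F⌉
    in G , G∈𝓕 , M⊆⌈G⌉ , λ n∈G → ⌈F⌉⊆Q (G⊆⌈F⌉ n∈G)

  module _ {d} {E : Pred Carrier d} (E-dir : IsDirected (𝔅 ℙ) E) where
    open IsDirected E-dir

    ⋃ : Pred Attr _
    ⋃ n = ∃ λ Q → Q ∈ E × n ∈ proj₁ Q

    finite⊆⋃ : ∀ M → fin M ⊆ ⋃ → ∃ λ Q → Q ∈ E × fin M ⊆ proj₁ Q
    finite⊆⋃ []      _   = let Q , Q∈E = nonempty in Q , Q∈E , λ { (lift ()) }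
    finite⊆⋃ (m ∷ M) M⊆⋃ =
      let Q₁ , Q₁∈E , m∈Q₁ = M⊆⋃ (lift (here refl))
          Q₂ , Q₂∈E , M⊆Q₂ = finite⊆⋃ M (λ (lift n∈M) → M⊆⋃ (lift (there n∈M)))
          Q , Q∈E , Q₁⊆Q , Q₂⊆Q = upward Q₁ Q₂ Q₁∈E Q₂∈E
      in Q , Q∈E , λ { (lift (here refl))  → Q₁⊆Q m∈Q₁
                     ; (lift (there n∈M)) → Q₂⊆Q (M⊆Q₂ (lift n∈M)) }

    -- `⋃` quantifies over concepts and so lives above the level of attribute sets; it must be
    -- resized to be a concept.
    ⋁ : Carrier
    ⋁ = Resize em _ ⋃ , λ M M⊆⋁ →
      let Q , Q∈E , M⊆Q = finite⊆⋃ M (proj₂ (Resize-≐ em _ ⋃) ∘ M⊆⋁)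
          F , F∈𝓕 , M⊆⌈F⌉ , ⌈F⌉⊆Q = proj₂ Q M M⊆Q
      in F , F∈𝓕 , M⊆⌈F⌉ , λ n∈⌈F⌉ → proj₁ (Resize-≐ em _ ⋃) (Q , Q∈E , ⌈F⌉⊆Q n∈⌈F⌉)

    ⋁-lub : IsLub (𝔅 ℙ) E ⋁
    ⋁-lub =
        (λ Q Q∈E n∈Q → proj₁ (Resize-≐ em _ ⋃) (Q , Q∈E , n∈Q))
      , (λ U U-ub n∈⋁ →
          let Q , Q∈E , n∈Q = proj₂ (Resize-≐ em _ ⋃) n∈⋁ in U-ub Q Q∈E n∈Q)

    -- `WayBelow` involves an arbitrary least upper bound; comparing it with `⋁` allows its elements
    -- to be traced to members of `E`.
    lub⊆⋃ : ∀ S → IsLub (𝔅 ℙ) E S → proj₁ S ⊆ ⋃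
    lub⊆⋃ S (_ , S-least) n∈S =
      proj₂ (Resize-≐ em _ ⋃) (S-least ⋁ (proj₁ ⋁-lub) n∈S)

  infix 4 _◁_
  -- A form of way-below that avoids the level `d` of the directed sets tested by `WayBelow`.
  _◁_ : Carrier → Carrier → Set _
  R ◁ Q = ∃ λ F → F ∈ 𝓕 × fin F ⊆ proj₁ Q × proj₁ R ⊆ ⌈ F ⌉

  ⌈⌉◁ : ∀ {F} (F∈𝓕 : F ∈ 𝓕) (Q : Carrier) → fin F ⊆ proj₁ Q → (⌈ F ⌉ , ⌈ F∈𝓕 ⌉-concept) ◁ Q
  ⌈⌉◁ {F} F∈𝓕 Q F⊆Q = F , F∈𝓕 , F⊆Q , λ n∈⌈F⌉ → n∈⌈F⌉

  ◁-directed : ∀ Q → IsDirected (𝔅 ℙ) (_◁ Q)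
  ◁-directed Q = record
    { nonempty =
        let F , F∈𝓕 , _ , F⊆Q = interpolate Q [] (λ { (lift ()) })
        in (⌈ F ⌉ , ⌈ F∈𝓕 ⌉-concept) , ⌈⌉◁ F∈𝓕 Q F⊆Q
    ; upward = λ R₁ R₂ (F₁ , _ , F₁⊆Q , R₁⊆⌈F₁⌉) (F₂ , _ , F₂⊆Q , R₂⊆⌈F₂⌉) →
        -- The concatenation is again a finite subset of `Q`, so one interpolation bounds both
        -- sides.
        let F , F∈𝓕 , F₁₂⊆⌈F⌉ , F⊆Q = interpolate Q (F₁ ++ F₂)
              (λ (lift n∈) → [ F₁⊆Q ∘ lift , F₂⊆Q ∘ lift ] (∈-++⁻ F₁ n∈))
        in (⌈ F ⌉ , ⌈ F∈𝓕 ⌉-concept) , ⌈⌉◁ F∈𝓕 Q F⊆Q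
         , (λ n∈R₁ → ⌈⌉-least (λ (lift n∈) → F₁₂⊆⌈F⌉ (lift (∈-++⁺ˡ n∈))) (R₁⊆⌈F₁⌉ n∈R₁))
         , (λ n∈R₂ → ⌈⌉-least (λ (lift n∈) → F₁₂⊆⌈F⌉ (lift (∈-++⁺ʳ F₁ n∈))) (R₂⊆⌈F₂⌉ n∈R₂))
    }

  ◁-lub : ∀ Q → IsLub (𝔅 ℙ) (_◁ Q) Q
  ◁-lub Q =
      (λ R (F , _ , F⊆Q , R⊆⌈F⌉) n∈R → ⌈⌉⊆concept Q F⊆Q (R⊆⌈F⌉ n∈R))
    , (λ U U-ub {n} n∈Q →
        let F , F∈𝓕 , n∈⌈F⌉ , F⊆Q = interpolate Q (n ∷ []) (λ { (lift (here refl)) → n∈Q })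
        in U-ub (⌈ F ⌉ , ⌈ F∈𝓕 ⌉-concept) (⌈⌉◁ F∈𝓕 Q F⊆Q) (n∈⌈F⌉ (lift (here refl))))

  module _ {d : Level} where

    -- The finite set `F` lies in a directed union, hence already in one member `T`, and then
    -- `⌈ F ⌉` lies in `T` too.
    ◁⇒≪ : ∀ {R Q} → R ◁ Q → WayBelow (𝔅 ℙ) d R Q
    ◁⇒≪ (F , _ , F⊆Q , R⊆⌈F⌉) E E-dir S S-lub Q⊆S =
      let T , T∈E , F⊆T = finite⊆⋃ E-dir F (λ n∈F → lub⊆⋃ E-dir S S-lub (Q⊆S (F⊆Q n∈F)))
      in T , T∈E , λ n∈R → ⌈⌉⊆concept T F⊆T (R⊆⌈F⌉ n∈R)

    -- Test `R ≪ Q` on the directed family of all `T ◁ Q`, whose least upper bound is `Q`.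
    ≪⇒◁ : ∀ {R Q} → WayBelow (𝔅 ℙ) d R Q → R ◁ Q
    ≪⇒◁ {R} {Q} R≪Q =
      let eq = Resize-≐ em d (_◁ Q)
          T , T∈ , R⊆T = R≪Q (Resize em d (_◁ Q)) (IsDirected-resp-≐ (𝔅 ℙ) eq (◁-directed Q))
                             Q (IsLub-resp-≐ (𝔅 ℙ) eq {Q} (◁-lub Q)) (λ n∈Q → n∈Q)
          F , F∈𝓕 , F⊆Q , T⊆⌈F⌉ = proj₂ eq {T} T∈
      in F , F∈𝓕 , F⊆Q , λ n∈R → T⊆⌈F⌉ (R⊆T n∈R)

    everything-isBasis : IsBasis (𝔅 ℙ) d (λ _ → ⊤)
    everything-isBasis Q =
      IsDirected-resp-≐ (𝔅 ℙ) eq (◁-directed Q) , IsLub-resp-≐ (𝔅 ℙ) eq {Q} (◁-lub Q)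
      where
      eq : (_◁ Q) ≐ BasisBelow (𝔅 ℙ) d (λ _ → ⊤) Q
      eq = (λ {R} R◁Q → _ , ◁⇒≪ {R} {Q} R◁Q) , (λ {R} (_ , R≪Q) → ≪⇒◁ {R} {Q} R≪Q)

    𝔅-isContinuousDomain : IsContinuousDomain (𝔅 ℙ) d
    𝔅-isContinuousDomain = record
      { isDcpo = record
        { nonempty = let F , F∈𝓕 = inhabited in ⌈ F ⌉ , ⌈ F∈𝓕 ⌉-concept
        ; complete = λ _ E-dir → ⋁ E-dir , ⋁-lub E-dir
        }
      ; hasBasis = _ , everything-isBasis
      }

  -- Meets of concepts and multiplicativity.

  module _ (multiplicative : IsMultiplicative ℙ) where
    open IsMultiplicative multiplicative

    infixr 7 _⊓_
    _⊓_ : Carrier → Carrier → Carrier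
    (Q₁ , Q₁-concept) ⊓ (Q₂ , Q₂-concept) = Q₁ ∩ Q₂ , λ M M⊆Q₁∩Q₂ →
      let F₁ , F₁∈𝓕 , M⊆⌈F₁⌉ , ⌈F₁⌉⊆Q₁ = Q₁-concept M (proj₁ ∘ M⊆Q₁∩Q₂)
          F₂ , F₂∈𝓕 , M⊆⌈F₂⌉ , ⌈F₂⌉⊆Q₂ = Q₂-concept M (proj₂ ∘ M⊆Q₁∩Q₂)
          F , F∈𝓕 , F⊆ , M⊆⌈F⌉ = SS1 F₁∈𝓕 F₂∈𝓕 M (λ n∈M → M⊆⌈F₁⌉ n∈M , M⊆⌈F₂⌉ n∈M)
      in F , F∈𝓕 , M⊆⌈F⌉ , λ n∈⌈F⌉ →
           ⌈F₁⌉⊆Q₁ (⌈⌉-least (proj₁ ∘ F⊆) n∈⌈F⌉) , ⌈F₂⌉⊆Q₂ (⌈⌉-least (proj₂ ∘ F⊆) n∈⌈F⌉)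

    ◁-multiplicative : ∀ R Q₁ Q₂ → R ◁ Q₁ → R ◁ Q₂ → R ◁ Q₁ ⊓ Q₂
    ◁-multiplicative R (_ , Q₁-concept) (_ , Q₂-concept)
                     (G₁ , G₁∈𝓕 , G₁⊆Q₁ , R⊆⌈G₁⌉) (G₂ , G₂∈𝓕 , G₂⊆Q₂ , R⊆⌈G₂⌉) =
      -- `SS2` compares pairs in `𝓕`, so an `Fᵢ` is inserted between each `Gᵢ` and `Qᵢ`.
      let F₁ , F₁∈𝓕 , G₁⊆⌈F₁⌉ , ⌈F₁⌉⊆Q₁ = Q₁-concept G₁ G₁⊆Q₁
          F₂ , F₂∈𝓕 , G₂⊆⌈F₂⌉ , ⌈F₂⌉⊆Q₂ = Q₂-concept G₂ G₂⊆Q₂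
          F , G , _ , G∈𝓕 , ⌈G₁⌉∩⌈G₂⌉⊆⌈G⌉ , G⊆⌈F⌉ , ⌈F⌉⊆ =
            SS2 F₁∈𝓕 F₂∈𝓕 G₁∈𝓕 G₂∈𝓕 G₁⊆⌈F₁⌉ G₂⊆⌈F₂⌉
      in G , G∈𝓕
       , (λ n∈G → let n∈⌈F₁⌉ , n∈⌈F₂⌉ = ⌈F⌉⊆ (G⊆⌈F⌉ n∈G) in ⌈F₁⌉⊆Q₁ n∈⌈F₁⌉ , ⌈F₂⌉⊆Q₂ n∈⌈F₂⌉)
       , (λ n∈R → ⌈G₁⌉∩⌈G₂⌉⊆⌈G⌉ (R⊆⌈G₁⌉ n∈R , R⊆⌈G₂⌉ n∈R))

    𝔅-isStablyContinuousSemilattice : ∀ {d} → IsStablyContinuousSemilattice (𝔅 ℙ) d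
    𝔅-isStablyContinuousSemilattice = record
      { isContinuousDomain = 𝔅-isContinuousDomain
      ; _∧_                = _⊓_
      ; isMeetSemilattice  = record
        { isPartialOrder = Poset.isPartialOrder (𝔅 ℙ)
        ; infimum        = λ _ _ → proj₁ , proj₂ , λ _ R⊆Q₁ R⊆Q₂ n∈R → R⊆Q₁ n∈R , R⊆Q₂ n∈R
        }
      ; multiplicative     = λ R Q₁ Q₂ R≪Q₁ R≪Q₂ →
          ◁⇒≪ {R = R} {Q = Q₁ ⊓ Q₂}
            (◁-multiplicative R Q₁ Q₂ (≪⇒◁ {R = R} {Q = Q₁} R≪Q₁) (≪⇒◁ {R = R} {Q = Q₂} R≪Q₂))
      }

-- The context of a stably continuous semilattice.

module _ (em : ∀ {ℓ} → ExcludedMiddle ℓ)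
         {c ℓ₁ ℓ₂ d} (D : Poset c ℓ₁ ℓ₂) (D-stable : IsStablyContinuousSemilattice D d)
         (B : Pred (Poset.Carrier D) d) (B-basis : IsBasis D d B) where
  open IsStablyContinuousSemilattice D-stable
  open IsContinuousDomain isContinuousDomain using (isDcpo)
  open IsMeetSemilattice isMeetSemilattice using (x∧y≤x; x∧y≤y)
  open Representation em D isDcpo B B-basis hiding (Rep)

  -- The maximum of `G` is an element of `G`, so it belongs to `⌈ F ⌉`.
  max≪max : ∀ {F G} (F∈𝓕 : F ∈ 𝓕) (G∈𝓕 : G ∈ 𝓕) → fin G ⊆ ⌈ F ⌉ → proj₁ G∈𝓕 ≪ proj₁ F∈𝓕
  max≪max F∈𝓕 (_ , _ , t∈G) G⊆⌈F⌉ with ∈-map⁻ (proj₁ {B = B}) t∈G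
  ... | m , m∈G , refl = ⌈⌉⇒≪ F∈𝓕 m (G⊆⌈F⌉ (lift m∈G))

  ≪∧⇒⌈⌉∩⌈⌉ : ∀ {F₁ F₂} (F₁∈𝓕 : F₁ ∈ 𝓕) (F₂∈𝓕 : F₂ ∈ 𝓕) b →
              proj₁ b ≪ proj₁ F₁∈𝓕 ∧ proj₁ F₂∈𝓕 → b ∈ ⌈ F₁ ⌉ ∩ ⌈ F₂ ⌉
  ≪∧⇒⌈⌉∩⌈⌉ F₁∈𝓕@(s₁ , _) F₂∈𝓕@(s₂ , _) b b≪s₁∧s₂ =
      ≪⇒⌈⌉ F₁∈𝓕 b (≪-≤-trans b≪s₁∧s₂ (x∧y≤x s₁ s₂))
    , ≪⇒⌈⌉ F₂∈𝓕 b (≪-≤-trans b≪s₁∧s₂ (x∧y≤y s₁ s₂))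

  ⌈⌉∩⌈⌉⇒≪∧ : ∀ {F₁ F₂} (F₁∈𝓕 : F₁ ∈ 𝓕) (F₂∈𝓕 : F₂ ∈ 𝓕) b →
              b ∈ ⌈ F₁ ⌉ ∩ ⌈ F₂ ⌉ → proj₁ b ≪ proj₁ F₁∈𝓕 ∧ proj₁ F₂∈𝓕
  ⌈⌉∩⌈⌉⇒≪∧ F₁∈𝓕@(s₁ , _) F₂∈𝓕@(s₂ , _) b (b∈⌈F₁⌉ , b∈⌈F₂⌉) =
    multiplicative (proj₁ b) s₁ s₂ (⌈⌉⇒≪ F₁∈𝓕 b b∈⌈F₁⌉) (⌈⌉⇒≪ F₂∈𝓕 b b∈⌈F₂⌉)

  Rep-SS1 : ∀ {F₁ F₂} → F₁ ∈ 𝓕 → F₂ ∈ 𝓕 → ∀ M → fin M ⊆ ⌈ F₁ ⌉ ∩ ⌈ F₂ ⌉ →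
            ∃ λ F → F ∈ 𝓕 × fin F ⊆ ⌈ F₁ ⌉ ∩ ⌈ F₂ ⌉ × fin M ⊆ ⌈ F ⌉
  Rep-SS1 F₁∈𝓕 F₂∈𝓕 M M⊆
    with interpolateAll M (λ {b} b∈M → ⌈⌉∩⌈⌉⇒≪∧ F₁∈𝓕 F₂∈𝓕 b (M⊆ (lift b∈M)))
  ... | x , x∈B , x≪s₁∧s₂ , M≪x =
      (x , x∈B) ∷ [] , singleton∈𝓕 (x , x∈B)
    , (λ { (lift (here refl)) → ≪∧⇒⌈⌉∩⌈⌉ F₁∈𝓕 F₂∈𝓕 (x , x∈B) x≪s₁∧s₂ })
    , (λ {b} (lift b∈M) → ≪⇒⌈⌉ (singleton∈𝓕 (x , x∈B)) b (M≪x b∈M))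

  -- Interpolating twice gives basis elements with `t₁ ∧ t₂ ≪ y ≪ x ≪ s₁ ∧ s₂`; the singletons of
  -- `x` and `y` serve as `F` and `G`. The meet `t₁ ∧ t₂` may fall outside `B`, which is why `y`
  -- takes its place.
  Rep-SS2 : ∀ {F₁ F₂ G₁ G₂} → F₁ ∈ 𝓕 → F₂ ∈ 𝓕 → G₁ ∈ 𝓕 → G₂ ∈ 𝓕 →
            fin G₁ ⊆ ⌈ F₁ ⌉ → fin G₂ ⊆ ⌈ F₂ ⌉ →
            ∃ λ F → ∃ λ G → F ∈ 𝓕 × G ∈ 𝓕 ×
              ⌈ G₁ ⌉ ∩ ⌈ G₂ ⌉ ⊆ ⌈ G ⌉ × fin G ⊆ ⌈ F ⌉ × ⌈ F ⌉ ⊆ ⌈ F₁ ⌉ ∩ ⌈ F₂ ⌉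
  Rep-SS2 F₁∈𝓕@(s₁ , _) F₂∈𝓕@(s₂ , _) G₁∈𝓕@(t₁ , _) G₂∈𝓕@(t₂ , _) G₁⊆⌈F₁⌉ G₂⊆⌈F₂⌉
    -- Each `tᵢ ≪ sᵢ`, so `t₁ ∧ t₂` is way below both `s₁` and `s₂`, hence below their meet.
    with interpolate (multiplicative (t₁ ∧ t₂) s₁ s₂
           (≤-≪-trans (x∧y≤x t₁ t₂) (max≪max F₁∈𝓕 G₁∈𝓕 G₁⊆⌈F₁⌉))
           (≤-≪-trans (x∧y≤y t₁ t₂) (max≪max F₂∈𝓕 G₂∈𝓕 G₂⊆⌈F₂⌉)))
  ... | x , x∈B , t₁∧t₂≪x , x≪s₁∧s₂ with interpolate t₁∧t₂≪x
  ... | y , y∈B , t₁∧t₂≪y , y≪x =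
      (x , x∈B) ∷ [] , (y , y∈B) ∷ [] , x∈𝓕 , singleton∈𝓕 (y , y∈B)
    , (λ {b} b∈ → ≪⇒⌈⌉ (singleton∈𝓕 (y , y∈B)) b
                    (≤-≪-trans (≪⇒≤ b (⌈⌉∩⌈⌉⇒≪∧ G₁∈𝓕 G₂∈𝓕 b b∈)) t₁∧t₂≪y))
    , (λ { (lift (here refl)) → ≪⇒⌈⌉ x∈𝓕 (y , y∈B) y≪x })
    , (λ {b} b∈⌈x⌉ → ≪∧⇒⌈⌉∩⌈⌉ F₁∈𝓕 F₂∈𝓕 b
                       (≪-≤-trans (⌈⌉⇒≪ x∈𝓕 b b∈⌈x⌉) (≪⇒≤ (x , x∈B) x≪s₁∧s₂)))
    where x∈𝓕 = singleton∈𝓕 (x , x∈B)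

proposition3p25 : (em : ∀ {ℓ} → ExcludedMiddle ℓ) →
    ∀ {o a r s f c ℓ₁ ℓ₂ d d′ : Level} →
    ((ℙ : AttributeContinuousContext o a r s f) →
    IsMultiplicative ℙ →
    IsStablyContinuousSemilattice (𝔅 ℙ) d)
    ×
    ((D : Poset c ℓ₁ ℓ₂) (D-stable : IsStablyContinuousSemilattice D d′)
    (B : Pred (Poset.Carrier D) d′) (B-basis : IsBasis D d′ B) →
    IsMultiplicative
    (Rep em D (IsContinuousDomain.isDcpo (IsStablyContinuousSemilattice.isContinuousDomain D-stable)) B B-basis))
-- The record is built here, not in a lemma about `Rep em`: instantiating
-- such a lemma produces `Rep (λ {ℓ} → em {ℓ})`, and Agda would compare it
-- with `Rep em` by unfolding all proofs inside Rep.
proposition3p25 em =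
    (λ ℙ multiplicative → Concepts.𝔅-isStablyContinuousSemilattice em ℙ multiplicative)
  , λ D D-stable B B-basis → record
      { SS1 = Rep-SS1 em D D-stable B B-basis
      ; SS2 = Rep-SS2 em D D-stable B B-basis
      }
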